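{- Let $G$ be a graph. Then all relations $R\subseteq V_G\times V_G$ satisfying $G\ast R=G$ are automorphisms of $G$ if and only if $G$ has property N.
   Context: Graphs are finite and undirected, with loops allowed: $G=(V_G,E_G)$ with $E_G\subseteq V_G\times V_G$ symmetric. For a graph $G$, a finite set $B$ and a relation $R\subseteq V_G\times B$ with full image (for every $b\in B$ there is $v\in V_G$ with $(v,b)\in R$), $G\ast R$ is the graph with vertex set $B$ and edge set $\{(u,v)\in B\times B : \text{there is } (x,y)\in E_G \text{ with } (x,u),(y,v)\in R\}$. The equation $G\ast R=H$ means that $R\subseteq V_G\times V_H$ has full image and $G\ast R$ equals $H$ as a graph. The relations $R$ here are not required to have full domain. A relation $R$ is called an automorphism of $G$ if $R=\{(x,f(x)):x\in V_G\}$ for some graph automorphism $f:V_G\to V_G$ of $G$. Let $N_G(x)=\{z\in V_G:(x,z)\in E_G\}$. $G$ has property N if, for all $x,y\in V_G$, $N_G(x)\subseteq N_G(y)$ implies $x=y$. -}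

module Defs where

open import Data.Fin.Base using (Fin)
import Data.Fin.Properties as Fin
open import Data.Nat.Base using (ℕ)
open import Data.Product.Base using (Σ-syntax; ∃-syntax; _×_; _,_)
open import Function.Bundles using (_↔_; Inverse)
open import Function.Definitions using (Bijective)
open import Level using (0ℓ)
open import Relation.Binary.Core using (Rel; REL; _⇔_)
open import Relation.Binary.Definitions using (Decidable; Symmetric)
open import Relation.Binary.PropositionalEquality using (_≡_; subst; sym)
open import Relation.Nullary.Decidable using (Dec; map′; _×-dec_)
open import Relation.Unary using (Pred; _⊆_)
import Relation.Unary as Unary

record FinSet : Set₁ where
  field
    Carrier     : Set
    size        : ℕ
    enumeration : Fin size ↔ Carrier

open FinSet public using () renaming (Carrier to ∣_∣)

-- Relations between finite sets, and edge sets, are subsets of a finite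
-- product; constructively these are the decidable relations.  Two of them
-- are the same subset when each implies the other, i.e. up to `_⇔_`.

record Relation (A B : FinSet) : Set₁ where
  field
    Related  : REL ∣ A ∣ ∣ B ∣ 0ℓ
    related? : Decidable Related

record Graph (V : FinSet) : Set₁ where
  field
    Edge      : Rel ∣ V ∣ 0ℓ
    edge?     : Decidable Edge
    symmetric : Symmetric Edge

open Relation public
open Graph public

any? : (A : FinSet) {P : Pred ∣ A ∣ 0ℓ} → Unary.Decidable P → Dec (∃[ a ] P a)
any? A {P} P? = map′
  (λ (i , p) → to i , p)
  (λ (a , p) → from a , subst P (sym (strictlyInverseˡ a)) p)
  (Fin.any? (λ i → P? (to i)))
  where open Inverse (FinSet.enumeration A)

FullImage : {A B : FinSet} → Relation A B → Set
FullImage R = ∀ b → ∃[ a ] Related R a b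

-- The construction makes sense for every R; full image is demanded where it
-- is used, in `_∗_≐_`.

infixl 7 _∗_
_∗_ : {V B : FinSet} → Graph V → Relation V B → Graph B
_∗_ {V} G R = record
  { Edge      = λ u v → ∃[ x ] ∃[ y ] Edge G x y × Related R x u × Related R y v
  ; edge?     = λ u v → any? V λ x → any? V λ y →
                  edge? G x y ×-dec related? R x u ×-dec related? R y v
  ; symmetric = λ (x , y , e , r , s) → y , x , symmetric G e , s , r
  }

infix 4 _∗_≐_
_∗_≐_ : {V W : FinSet} → Graph V → Relation V W → Graph W → Set
G ∗ R ≐ H = FullImage R × (Edge (G ∗ R) ⇔ Edge H)

record IsGraphAutomorphism {V : FinSet} (G : Graph V) (f : ∣ V ∣ → ∣ V ∣) : Set where
  field
    bijective : Bijective _≡_ _≡_ f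
    edges     : Edge G ⇔ (λ x y → Edge G (f x) (f y))

IsAutomorphism : {V : FinSet} → Graph V → Relation V V → Set
IsAutomorphism {V} G R =
  Σ[ f ∈ (∣ V ∣ → ∣ V ∣) ] IsGraphAutomorphism G f × (Related R ⇔ (λ x y → f x ≡ y))

N : {V : FinSet} → Graph V → ∣ V ∣ → Pred ∣ V ∣ 0ℓ
N G x = λ z → Edge G x z

PropertyN : {V : FinSet} → Graph V → Set
PropertyN G = ∀ x y → N G x ⊆ N G y → x ≡ y

{-# OPTIONS --safe #-}
-- If N(x) ⊆ N(y), the identity relation with (x , y) added leaves G unchanged, and
-- it is a function only when x = y.  Conversely let G have property N and G ∗ R = G.
-- By finiteness Rⁱ⁺ᵖ = Rⁱ for some i and some p ≥ 1.  If x ~ z and x Rᵖ u, lift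
-- the edge to x' ~ z' with x' Rⁱ x and z' Rⁱ z; then x' Rⁱ⁺ᵖ u, hence x' Rⁱ u,
-- and pushing the lifted edge forward gives u ~ z.  So x Rᵖ u implies
-- N(x) ⊆ N(u), and under property N the relation Rᵖ is the identity; thus R is a
-- permutation, with inverse Rᵖ⁻¹.
module Submission where

open import Defs
open import Data.Fin.Base using (Fin; zero; suc; toℕ; funToFin; finToFun)
open import Data.Fin.Properties using (_≟_; finToFun-funToFin; pigeonhole)
open import Data.Nat.Base using (ℕ; zero; suc; _+_; _^_)
open import Data.Nat.Properties using (n<1+n; m≤n⇒∃[o]m+o≡n; +-suc; +-comm)
open import Data.Product.Base using (∃-syntax; _×_; _,_; proj₁; proj₂)
open import Data.Sum.Base using (inj₁; inj₂; _⊎_)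
open import Function.Bundles using (_⇔_; mk⇔; Inverse)
open import Function.Properties.Inverse using (↔-sym; Inverse⇒Injection)
import Relation.Binary.Core as Binary
open import Relation.Binary.Definitions using (DecidableEquality)
open import Relation.Binary.PropositionalEquality
  using (_≡_; _≗_; refl; sym; trans; cong; subst; subst₂)
open import Relation.Nullary.Decidable
  using (Dec; yes; no; via-injection; _×-dec_; _⊎-dec_)
open import Relation.Unary using (_⊆_)

decEq : (V : FinSet) → DecidableEquality ∣ V ∣
decEq V = via-injection (Inverse⇒Injection (↔-sym (FinSet.enumeration V))) _≟_

identity : {V : FinSet} → Relation V V
identity {V} = record { Related = _≡_ ; related? = decEq V }

infixr 9 _⨾_
_⨾_ : {A B C : FinSet} → Relation A B → Relation B C → Relation A C
_⨾_ {B = B} R S = record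
  { Related  = λ x z → ∃[ y ] Related R x y × Related S y z
  ; related? = λ x z → any? B λ y → related? R x y ×-dec related? S y z
  }

power : {V : FinSet} → Relation V V → ℕ → Relation V V
power R zero    = identity
power R (suc k) = R ⨾ power R k

infix 4 _≋_
_≋_ : {A B : FinSet} → Relation A B → Relation A B → Set
R ≋ S = Related R Binary.⇔ Related S

bit : {P : Set} → Dec P → Fin 2
bit (yes _) = suc zero
bit (no _)  = zero

bit-injective : {P Q : Set} (P? : Dec P) (Q? : Dec Q) → bit P? ≡ bit Q? → P → Q
bit-injective _       (yes q) _  _ = q
bit-injective (yes _) (no _)  () _
bit-injective (no ¬p) (no _)  _  p with () ← ¬p p

funToFin-injective : ∀ {m n} (f g : Fin m → Fin n) → funToFin f ≡ funToFin g → f ≗ g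
funToFin-injective f g eq i =
  trans (sym (finToFun-funToFin f i))
    (trans (cong (λ c → finToFun c i) eq) (finToFun-funToFin g i))

module _ {A B : FinSet} where
  open FinSet using (size; enumeration)
  private
    module A = Inverse (enumeration A)
    module B = Inverse (enumeration B)

  -- The truth table read as a number: up to `_≋_` there are only finitely many relations, so the
  -- pigeonhole principle applies to them.
  code : Relation A B → Fin ((2 ^ size B) ^ size A)
  code R = funToFin λ i → funToFin λ j → bit (related? R (A.to i) (B.to j))

  code-injective-⇒ : (R S : Relation A B) → code R ≡ code S →
                     Related R Binary.⇒ Related S
  code-injective-⇒ R S eq {x} {y} r =
    subst₂ (Related S) (A.strictlyInverseˡ x) (B.strictlyInverseˡ y)
      (bit-injective (related? R _ _) (related? S _ _)
        (funToFin-injective _ _ (funToFin-injective _ _ eq (A.from x)) (B.from y))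
        (subst₂ (Related R) (sym (A.strictlyInverseˡ x)) (sym (B.strictlyInverseˡ y)) r))

  code-injective : (R S : Relation A B) → code R ≡ code S → R ≋ S
  code-injective R S eq = code-injective-⇒ R S eq , code-injective-⇒ S R (sym eq)

power-periodic : {V : FinSet} (R : Relation V V) →
                 ∃[ i ] ∃[ q ] power R i ≋ power R (i + suc q)
power-periodic R
  with i , j , i<j , eq ← pigeonhole (n<1+n _) (λ k → code (power R (toℕ k)))
  -- `i<j` unfolds to `suc (toℕ i) ≤ toℕ j`, so the period is `suc q` and hence positive.
  with q , i+q≡j ← m≤n⇒∃[o]m+o≡n i<j
  = toℕ i , q ,
    subst (λ k → power R (toℕ i) ≋ power R k)
      (sym (trans (+-suc (toℕ i) q) i+q≡j))
      (code-injective (power R (toℕ i)) (power R (toℕ j)) eq)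

module _ {V : FinSet} (R : Relation V V) where

  power-+ : ∀ i j {x y z} → Related (power R i) x y → Related (power R j) y z →
            Related (power R (i + j)) x z
  power-+ zero    j refl        s = s
  power-+ (suc i) j (w , r , t) s = w , r , power-+ i j t s

  -- `power` splits off its first step; here a step is appended at the end instead.
  power-suc : ∀ k {x y z} → Related (power R k) x y → Related R y z →
              Related (power R (suc k)) x z
  power-suc k {x} {z = z} s r =
    subst (λ n → Related (power R n) x z) (+-comm k 1) (power-+ k 1 s (z , r , refl))

  power-fullImage : FullImage R → ∀ k → FullImage (power R k)
  power-fullImage full zero    z = z , refl
  power-fullImage full (suc k) z
    with y , s ← power-fullImage full k z
    with x , r ← full y
    = x , y , r , s

  -- Acting by `R ⨾ S` is acting by `R`, then by `S`. So pushing an edge goes through `R` first,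
  -- while lifting goes back through the power first and through `R` last.
  ∗-power : (G : Graph V) → G ∗ R ≐ G → ∀ k → G ∗ power R k ≐ G
  ∗-power G (full , push , lift) k = power-fullImage full k , push^ k , lift^ k
    where
    push^ : ∀ k → Edge (G ∗ power R k) Binary.⇒ Edge G
    push^ zero    (_ , _ , e , refl , refl) = e
    push^ (suc k) (x , y , e , (x' , r , r') , (y' , s , s')) =
      push^ k (x' , y' , push (x , y , e , r , s) , r' , s')

    lift^ : ∀ k → Edge G Binary.⇒ Edge (G ∗ power R k)
    lift^ zero    e = _ , _ , e , refl , refl
    lift^ (suc k) e
      with x' , y' , e' , r' , s' ← lift^ k e
      with x , y , e'' , r , s ← lift e'
      = x , y , e'' , (x' , r , r') , (y' , s , s')

  power⊆N : (G : Graph V) → G ∗ R ≐ G → ∀ i p → power R i ≋ power R (i + p) →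
            ∀ {x u} → Related (power R p) x u → N G x ⊆ N G u
  power⊆N G fix i p (_ , shrink) xu e
    with _ , push , lift ← ∗-power G fix i
    with x' , z' , e' , x'x , z'z ← lift e
    -- Both ends are pushed along the same power `i`; the first one can land on `u` because `i + p`
    -- steps shrink to `i`.
    = push (x' , z' , e' , shrink (power-+ i p x'x xu) , z'z)

  periodic⇒automorphism : (G : Graph V) → G ∗ R ≐ G → ∀ q →
                          power R (suc q) ≋ identity → IsAutomorphism G R
  periodic⇒automorphism G (full , push , lift) q (toId , fromId) =
    f , record { bijective = injective , surjective ; edges = pushEdge , liftEdge }
      , R⇒f , f⇒R
    where
    -- The first stop on a walk of `suc q` steps from `x` back to itself.
    f : ∣ V ∣ → ∣ V ∣
    f x = proj₁ (fromId {x} refl)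

    R-f : ∀ x → Related R x (f x)
    R-f x = proj₁ (proj₂ (fromId {x} refl))

    -- Some `w` reaches `x` in `q` steps and hence `u` in `suc q`, which forces `w` to be `u`.
    inverse : ∀ {x u} → Related R x u → Related (power R q) u x
    inverse {x} {u} r
      with w , s ← power-fullImage full q x
      with refl ← toId (power-suc q s r)
      = s

    functional : ∀ {x u v} → Related R x u → Related R x v → u ≡ v
    functional r s = toId (power-suc q (inverse r) s)

    cofunctional : ∀ {x y u} → Related R x u → Related R y u → x ≡ y
    cofunctional r s = toId (_ , r , inverse s)

    R⇒f : ∀ {x y} → Related R x y → f x ≡ y
    R⇒f r = functional (R-f _) r

    f⇒R : ∀ {x y} → f x ≡ y → Related R x y
    f⇒R refl = R-f _

    injective : ∀ {x y} → f x ≡ f y → x ≡ y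
    injective eq = cofunctional (f⇒R eq) (R-f _)

    surjective : ∀ y → ∃[ x ] (∀ {z} → z ≡ x → f z ≡ y)
    surjective y with x , r ← full y = x , λ { refl → R⇒f r }

    pushEdge : ∀ {x y} → Edge G x y → Edge G (f x) (f y)
    pushEdge e = push (_ , _ , e , R-f _ , R-f _)

    liftEdge : ∀ {x y} → Edge G (f x) (f y) → Edge G x y
    liftEdge e with a , b , e' , r , s ← lift e =
      -- The lifted ends `a` and `b` are predecessors of `f x` and `f y`, hence are `x` and `y`.
      subst₂ (Edge G) (cofunctional r (R-f _)) (cofunctional s (R-f _)) e'

-- The ends are replaced one at a time, with the edge reversed in between.
N-monotone⇒push : {V : FinSet} (G : Graph V) (R : Relation V V) →
                  (∀ {x u} → Related R x u → N G x ⊆ N G u) →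
                  Edge (G ∗ R) Binary.⇒ Edge G
N-monotone⇒push G R mono (x , y , e , r , s) =
  symmetric G (mono s (symmetric G (mono r e)))

identityWith : {V : FinSet} → ∣ V ∣ → ∣ V ∣ → Relation V V
identityWith {V} x y = record
  { Related  = λ a u → a ≡ u ⊎ (a ≡ x × u ≡ y)
  ; related? = λ a u → decEq V a u ⊎-dec (decEq V a x ×-dec decEq V u y)
  }

∗-identityWith : {V : FinSet} (G : Graph V) {x y : ∣ V ∣} → N G x ⊆ N G y →
                 G ∗ identityWith x y ≐ G
∗-identityWith {V} G {x} {y} x⊆y =
    (λ b → b , inj₁ refl)
  , N-monotone⇒push G (identityWith x y) mono
  , (λ e → _ , _ , e , inj₁ refl , inj₁ refl)
  where
  mono : ∀ {a u} → Related (identityWith {V} x y) a u → N G a ⊆ N G u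
  mono (inj₁ refl)          e = e
  mono (inj₂ (refl , refl)) e = x⊆y e

automorphisms⇒propertyN : {V : FinSet} (G : Graph V) →
  ((R : Relation V V) → G ∗ R ≐ G → IsAutomorphism G R) → PropertyN G
automorphisms⇒propertyN G auto x y x⊆y
  with _ , _ , R⇒f , _ ← auto (identityWith x y) (∗-identityWith G x⊆y)
  -- `x` is related both to itself and to `y`, so `f x` equals both.
  = trans (sym (R⇒f (inj₁ refl))) (R⇒f (inj₂ (refl , refl)))

propertyN⇒automorphism : {V : FinSet} (G : Graph V) → PropertyN G →
  (R : Relation V V) → G ∗ R ≐ G → IsAutomorphism G R
propertyN⇒automorphism G propN R fix
  with i , q , period ← power-periodic R
  = periodic⇒automorphism R G fix q (toId , fromId)
  where
  toId : ∀ {x u} → Related (power R (suc q)) x u → x ≡ u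
  toId {x} {u} r = propN x u (power⊆N R G fix i (suc q) period r)

  fromId : ∀ {x u} → x ≡ u → Related (power R (suc q)) x u
  fromId {x} refl
    -- Property N only puts the power inside the identity; full image supplies a predecessor of `x`,
    -- which can only be `x`.
    with w , r ← power-fullImage R (proj₁ fix) (suc q) x
    with refl ← toId r
    = r

theorem4p7 : (V : FinSet) (G : Graph V) →
    ((R : Relation V V) → G ∗ R ≐ G → IsAutomorphism G R) ⇔ PropertyN G
theorem4p7 V G = mk⇔ (automorphisms⇒propertyN G) (propertyN⇒automorphism G)
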